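{- Let $S_1 = (G_1, \sigma_1)$ and $S_2 = (G_2, \sigma_2)$ be edge-disjoint signed graphs and let $S = S_1 \square S_2$ be their Cartesian product. If $\chi'(S_1) = \Delta(S_1)$ and $\chi'(S_2) = \Delta(S_2)$, then $\chi'(S) = \Delta(S)$.
   Context: All graphs are simple, finite and undirected. A signed graph is a pair $S=(G,\sigma)$ where $G$ is a graph and $\sigma\colon E(G)\to\{+1,-1\}$; $G$ is the underlying graph. $V(S)$, $E(S)$ and $\Delta(S)$ (maximum degree) refer to the underlying graph. An incidence is a pair $v\text{:}e$ of a vertex $v$ and an edge $e$ having $v$ as an endpoint; $I(G)$ is the set of all incidences. For a positive integer $k$ let $M_k=\{0,\pm1,\ldots,\pm l\}$ if $k=2l+1$ and $M_k=\{\pm1,\ldots,\pm l\}$ if $k=2l$. A $k$-edge-coloring of $S=(G,\sigma)$ is a function $f\colon I(G)\to M_k$ such that $f(u\text{:}uv)=-\sigma(uv)f(v\text{:}uv)$ for each edge $uv$, and $f(u\text{:}uv_1)\neq f(u\text{:}uv_2)$ for any two distinct edges $uv_1\neq uv_2$ at a common vertex $u$. The chromatic index $\chi'(S)$ is the smallest $k$ for which $S$ has a $k$-edge-coloring; a signed graph with no edges has chromatic index $0$. The Cartesian product $S_1\square S_2$ of signed graphs $S_1=(G_1,\sigma_1)$, $S_2=(G_2,\sigma_2)$ is the signed graph with vertex set $V(S_1)\times V(S_2)$ in which $(u,u')(v,v')$ is an edge iff either $u=v$ and $u'v'\in E(S_2)$ (the sign is then $\sigma_2(u'v')$), or $uv\in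 E(S_1)$ and $u'=v'$ (the sign is then $\sigma_1(uv)$). -}

module Defs where

open import Data.Nat using (ℕ; _+_; _*_; _≤_)
open import Data.Integer as ℤ using (ℤ; ∣_∣; 0ℤ; -_; _◃_)
open import Data.Sign using (Sign)
open import Data.List using (List; map; filter; length; cartesianProduct)
open import Data.List.Extrema.Nat using (max)
open import Data.List.Membership.Propositional using (_∈_)
open import Data.List.Membership.Propositional.Properties using (∈-cartesianProduct⁺)
import Data.List.Membership.DecPropositional as DecMembership
open import Data.List.Relation.Unary.Unique.Propositional using (Unique)
open import Data.List.Relation.Unary.Unique.Propositional.Properties using (cartesianProduct⁺)
open import Data.Product using (_×_; _,_)
open import Data.Product.Properties using (≡-dec)
open import Data.Sum using (_⊎_; inj₁; inj₂)
open import Data.Empty using (⊥-elim)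
open import Relation.Nullary using (¬_; Dec)
open import Relation.Nullary.Decidable using (_×-dec_; _⊎-dec_)
open import Relation.Binary.Definitions using (DecidableEquality)
open import Relation.Binary.PropositionalEquality using (_≡_; _≢_; refl)

-- A finite simple signed graph whose vertices are drawn from an ambient type U,
-- so that two graphs over the same U may share vertices or edges.
record SignedGraph (U : Set) : Set₁ where
  field
    _≟_       : DecidableEquality U
    vertices  : List U
    unique    : Unique vertices
    Adj       : U → U → Set
    Adj?      : ∀ u v → Dec (Adj u v)
    Adj-∈     : ∀ {u v} → Adj u v → u ∈ vertices
    Adj-sym   : ∀ {u v} → Adj u v → Adj v u
    Adj-irr   : ∀ {u} → ¬ Adj u u
    σ         : ∀ {u v} → Adj u v → Sign
    -- Together with Adj-sym, this says that σ depends only on the unordered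
    -- pair uv: neither on its orientation nor on the proof of adjacency.
    σ-edge    : ∀ {u v} (e : Adj u v) (e′ : Adj v u) → σ e ≡ σ e′

  degree : U → ℕ
  degree u = length (filter (Adj? u) vertices)

  Δ : ℕ
  Δ = max 0 (map degree vertices)

EdgeDisjoint : ∀ {U} → SignedGraph U → SignedGraph U → Set
EdgeDisjoint S₁ S₂ = ∀ u v → Adj S₁ u v → ¬ Adj S₂ u v
  where open SignedGraph

-- M 0 is empty, so exactly the edgeless graphs are 0-edge-colorable, in
-- agreement with the convention that their chromatic index is 0.
data _∈M_ (z : ℤ) (k : ℕ) : Set where
  odd  : ∀ l → k ≡ 2 * l + 1 → ∣ z ∣ ≤ l → z ∈M k
  even : ∀ l → k ≡ 2 * l → z ≢ 0ℤ → ∣ z ∣ ≤ l → z ∈M k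

-- The incidence u:uv is encoded as the ordered adjacent pair e : Adj u v.
-- The field `signed`, by symmetry of Adj and σ-edge, also makes the color
-- independent of the proof of adjacency.
record EdgeColoring {U : Set} (S : SignedGraph U) (k : ℕ) : Set where
  open SignedGraph S
  field
    color  : ∀ {u v} → Adj u v → ℤ
    range  : ∀ {u v} (e : Adj u v) → color e ∈M k
    signed : ∀ {u v} (e : Adj u v) (e′ : Adj v u) →
             color e ≡ (- (σ e ◃ 1)) ℤ.* color e′
    proper : ∀ {u v w} (e : Adj u v) (e′ : Adj u w) →
             v ≢ w → color e ≢ color e′

-- "χ′(S) = k", with χ′ rendered as a functional relation.
ChromaticIndex : ∀ {U} → SignedGraph U → ℕ → Set
ChromaticIndex S k = EdgeColoring S k × (∀ j → EdgeColoring S j → k ≤ j)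

infixr 7 _□_

_□_ : ∀ {U W} → SignedGraph U → SignedGraph W → SignedGraph (U × W)
_□_ {U} {W} S₁ S₂ = record
  { _≟_      = ≡-dec A._≟_ B._≟_
  ; vertices = cartesianProduct A.vertices B.vertices
  ; unique   = cartesianProduct⁺ A.unique B.unique
  ; Adj      = Adj
  ; Adj?     = λ { (u , u′) (v , v′) →
                 ((u A.≟ v) ×-dec (u ∈A? A.vertices) ×-dec B.Adj? u′ v′)
                 ⊎-dec
                 (A.Adj? u v ×-dec (u′ B.≟ v′) ×-dec (u′ ∈B? B.vertices)) }
  ; Adj-∈    = λ { (inj₁ (_ , u∈ , e)) → ∈-cartesianProduct⁺ u∈ (B.Adj-∈ e)
                 ; (inj₂ (e , _ , u∈)) → ∈-cartesianProduct⁺ (A.Adj-∈ e) u∈ }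
  ; Adj-sym  = λ { (inj₁ (refl , u∈ , e)) → inj₁ (refl , u∈ , B.Adj-sym e)
                 ; (inj₂ (e , refl , u∈)) → inj₂ (A.Adj-sym e , refl , u∈) }
  ; Adj-irr  = λ { (inj₁ (_ , _ , e)) → B.Adj-irr e
                 ; (inj₂ (e , _ , _)) → A.Adj-irr e }
  ; σ        = σ
  ; σ-edge   = σ-edge
  }
  where
  module A = SignedGraph S₁
  module B = SignedGraph S₂
  open DecMembership A._≟_ using () renaming (_∈?_ to _∈A?_)
  open DecMembership B._≟_ using () renaming (_∈?_ to _∈B?_)

  Adj : U × W → U × W → Set
  Adj (u , u′) (v , v′) =
    (u ≡ v × u ∈ A.vertices × B.Adj u′ v′) ⊎
    (A.Adj u v × u′ ≡ v′ × u′ ∈ B.vertices)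

  σ : ∀ {p q} → Adj p q → Sign
  σ (inj₁ (_ , _ , e)) = B.σ e
  σ (inj₂ (e , _ , _)) = A.σ e

  σ-edge : ∀ {p q} (e : Adj p q) (e′ : Adj q p) → σ e ≡ σ e′
  σ-edge (inj₁ (_ , _ , e))    (inj₁ (_ , _ , e′)) = B.σ-edge e e′
  σ-edge (inj₁ (refl , _ , _)) (inj₂ (e′ , _ , _)) = ⊥-elim (A.Adj-irr e′)
  σ-edge (inj₂ (e , _ , _))    (inj₁ (refl , _ , _)) = ⊥-elim (A.Adj-irr e)
  σ-edge (inj₂ (e , _ , _))    (inj₂ (e′ , _ , _)) = A.σ-edge e e′

{-# OPTIONS --safe #-}

-- A vertex of degree d sees d colors, so Δ is always a lower bound, and
-- Δ(S) = Δ(S₁) + Δ(S₂) unless a factor has no vertices.  It remains to color S.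
-- Let a and b be the largest absolute values in M_Δ(S₁) and M_Δ(S₂).  Nonzero
-- colors of S₁ are kept and those of S₂ are pushed outwards by a, so only edges
-- colored 0 are in conflict.  If Δ(S₁) or Δ(S₂) is even, at most one factor uses
-- 0, and 0 is kept.  If both are odd, then 0 is not available in the product,
-- and the edges colored 0 get ±c with c = a + b + 1.  In each factor these edges
-- form a matching, so there are signs g on the vertices with
-- g v = − σ(uv) · g u on each of them.  At (u , u′) give the 0-edge
-- inherited from S₁ the color g₁ u · g₂ u′ · c and the one inherited from
-- S₂ its negative.
module Submission where

open import Defs
open SignedGraph using (Δ)

open import Data.Empty using (⊥-elim)
open import Data.Fin using (Fin; zero; suc; fromℕ<)
open import Data.Fin.Properties using (injective⇒≤; fromℕ<-injective)
open import Data.Integer as ℤ using (ℤ; -[1+_]; +[1+_]; +0; 0ℤ; ∣_∣; _◃_; -_)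
import Data.Integer.Properties as ℤₚ
open import Data.List using (List; []; _∷_; map; filter; length; lookup; _++_)
open import Data.List.Extrema.Nat using (max≤v⁺; xs≤max; argmax-sel)
open import Data.List.Membership.Propositional using (_∈_; find; lose)
open import Data.List.Membership.Propositional.Properties
  using (∈-lookup; ∈-filter⁺; ∈-filter⁻; ∈-map⁺; ∈-map⁻; ∈-++⁻; ∈-cartesianProduct⁺; ∈-cartesianProduct⁻)
import Data.List.Membership.Setoid.Properties as Membershipₛ
open import Data.List.Properties using (length-++; length-map)
open import Data.List.Relation.Binary.Subset.Propositional using (_⊆_)
import Data.List.Relation.Unary.All as All
import Data.List.Relation.Unary.All.Properties as Allₚ
open import Data.List.Relation.Unary.AllPairs using ([]; _∷_)
open import Data.List.Relation.Unary.Any as Any using (here; there; any?)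
open import Data.List.Relation.Unary.Unique.Propositional using (Unique)
open import Data.List.Relation.Unary.Unique.Propositional.Properties
  using (map⁺; ++⁺; filter⁺)
open import Data.Nat using (ℕ; zero; suc; pred; _+_; _*_; _≤_; _<_; z≤n; s≤s; NonZero)
open import Data.Nat.Properties hiding (_≟_)
open import Data.Nat.Tactic.RingSolver using (solve-∀)
open import Data.Product using (Σ; ∃; _×_; _,_; proj₁; proj₂)
open import Data.Product.Properties using (,-injectiveˡ; ,-injectiveʳ)
open import Data.Sign as Sign using (Sign; opposite)
import Data.Sign.Properties as Signₚ
open import Data.Sum using (_⊎_; inj₁; inj₂; [_,_]′)
open import Relation.Nullary using (¬_; Dec; yes; no; contradiction)
open import Relation.Nullary.Decidable using (decidable-stable)
open import Relation.Binary.PropositionalEquality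

private
  variable
    A : Set
    U W : Set
    k : ℕ

-- Lists without repetition.

lookup-injective : {xs : List A} → Unique xs →
                   ∀ {i j} → lookup xs i ≡ lookup xs j → i ≡ j
lookup-injective (_ ∷ _) {zero} {zero} _ = refl
lookup-injective (x∉ ∷ _) {zero} {suc j} eq = contradiction eq (All.lookup x∉ (∈-lookup j))
lookup-injective (x∉ ∷ _) {suc i} {zero} eq = contradiction (sym eq) (All.lookup x∉ (∈-lookup i))
lookup-injective (_ ∷ uniq) {suc i} {suc j} eq = cong suc (lookup-injective uniq eq)

Unique-⊆⇒length≤ : {xs ys : List A} → Unique xs → xs ⊆ ys → length xs ≤ length ys
Unique-⊆⇒length≤ {xs = xs} uniq xs⊆ys =
  injective⇒≤ {f = λ i → Any.index (xs⊆ys (∈-lookup {xs = xs} i))} λ eq →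
    lookup-injective uniq (Membershipₛ.index-injective (setoid _) _ _ eq)

-- The palettes M k

parity : ∀ k → ∃ λ l → k ≡ 2 * l ⊎ k ≡ 2 * l + 1
parity zero = 0 , inj₁ refl
parity (suc k) with parity k
... | l , inj₁ refl = l , inj₂ (+-comm 1 (2 * l))
... | l , inj₂ refl = suc l , inj₁ (eq l)
  where
  eq : ∀ l → suc (2 * l + 1) ≡ 2 * suc l
  eq = solve-∀

2*m≢2*n+1 : ∀ m n → 2 * m ≢ 2 * n + 1
2*m≢2*n+1 m n eq = even≢odd m n (trans eq (+-comm (2 * n) 1))

∈M-even⁻ : ∀ {z} l → z ∈M (2 * l) → z ≢ 0ℤ × ∣ z ∣ ≤ l
∈M-even⁻ l (odd l′ eq _) = contradiction eq (2*m≢2*n+1 l l′)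
∈M-even⁻ l (even l′ eq z≢0 z≤) with refl ← *-cancelˡ-≡ l l′ 2 eq = z≢0 , z≤

∈M-odd⁻ : ∀ {z} l → z ∈M (2 * l + 1) → ∣ z ∣ ≤ l
∈M-odd⁻ l (odd l′ eq z≤) with refl ← *-cancelˡ-≡ l l′ 2 (+-cancelʳ-≡ 1 _ _ eq) = z≤
∈M-odd⁻ l (even l′ eq _ _) = contradiction (sym eq) (2*m≢2*n+1 l′ l)

-- This enumerates the integers as 0, 1, -1, 2, -2 and so on, so that absolute value at most `l`
-- means code at most `2 * l`. Both kinds of palette thus become intervals of codes.
ℤ→ℕ : ℤ → ℕ
ℤ→ℕ +0       = 0
ℤ→ℕ +[1+ n ] = suc (2 * n)
ℤ→ℕ -[1+ n ] = 2 * suc n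

ℤ→ℕ-injective : ∀ x y → ℤ→ℕ x ≡ ℤ→ℕ y → x ≡ y
ℤ→ℕ-injective +0       +0       _  = refl
ℤ→ℕ-injective +[1+ m ] +[1+ n ] eq = cong +[1+_] (*-cancelˡ-≡ m n 2 (suc-injective eq))
ℤ→ℕ-injective +[1+ m ] -[1+ n ] eq = contradiction (sym eq) (even≢odd (suc n) m)
ℤ→ℕ-injective -[1+ m ] +[1+ n ] eq = contradiction eq (even≢odd (suc m) n)
ℤ→ℕ-injective -[1+ m ] -[1+ n ] eq = cong -[1+_] (suc-injective (*-cancelˡ-≡ (suc m) (suc n) 2 eq))

ℤ→ℕ-≤ : ∀ z {l} → ∣ z ∣ ≤ l → ℤ→ℕ z ≤ 2 * l
ℤ→ℕ-≤ +0       _  = z≤n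
ℤ→ℕ-≤ +[1+ n ] le =
  ≤-trans (≤-trans (n≤1+n _) (≤-reflexive (sym (*-suc 2 n)))) (*-monoʳ-≤ 2 le)
ℤ→ℕ-≤ -[1+ n ] le = *-monoʳ-≤ 2 le

ℤ→ℕ≢0 : ∀ {z} → z ≢ 0ℤ → NonZero (ℤ→ℕ z)
ℤ→ℕ≢0 {+0}       z≢0 = contradiction refl z≢0
ℤ→ℕ≢0 {+[1+ _ ]} _   = _
ℤ→ℕ≢0 { -[1+ _ ]} _  = _

-- A form of "`M k` has at most `k` elements" suited to predicates: the index may depend on the
-- membership proof, but equal indices force equal integers.
record M-Index (k : ℕ) : Set where
  field
    index     : ∀ {z} → z ∈M k → Fin k
    injective : ∀ {x y} (x∈ : x ∈M k) (y∈ : y ∈M k) → index x∈ ≡ index y∈ → x ≡ y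

M-index : ∀ k → M-Index k
M-index k with parity k
... | l , inj₁ refl = record
  { index     = λ z∈ → fromℕ< (bound z∈)
  ; injective = λ x∈ y∈ eq → ℤ→ℕ-injective _ _
      (pred-injective {{ℤ→ℕ≢0 (proj₁ (∈M-even⁻ l x∈))}} {{ℤ→ℕ≢0 (proj₁ (∈M-even⁻ l y∈))}}
        (fromℕ<-injective _ _ (bound x∈) (bound y∈) eq))
  }
  where
  -- An even palette lacks 0, so its codes start at 1 and `pred` moves them down to start at 0.
  bound : ∀ {z} → z ∈M (2 * l) → pred (ℤ→ℕ z) < 2 * l
  bound {z} z∈ with ∈M-even⁻ l z∈
  ... | z≢0 , z≤ =
    ≤-trans (≤-reflexive (suc-pred (ℤ→ℕ z) {{ℤ→ℕ≢0 z≢0}})) (ℤ→ℕ-≤ z z≤)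
... | l , inj₂ refl = record
  { index     = λ z∈ → fromℕ< (bound z∈)
  ; injective = λ x∈ y∈ eq → ℤ→ℕ-injective _ _ (fromℕ<-injective _ _ (bound x∈) (bound y∈) eq)
  }
  where
  bound : ∀ {z} → z ∈M (2 * l + 1) → ℤ→ℕ z < 2 * l + 1
  bound {z} z∈ = ≤-trans (s≤s (ℤ→ℕ-≤ z (∈M-odd⁻ l z∈))) (≤-reflexive (+-comm 1 (2 * l)))

-- Here `c` is the absolute value given to incidences colored 0. `fresh` keeps it away from 1 to
-- `a + b`, the absolute values of the shifted nonzero colors; `clash` makes `c` and its negative
-- differ when both palettes contain 0.
record JointPalette (j k : ℕ) : Set where
  field
    a b c    : ℕ
    bound₁   : ∀ {z} → z ∈M j → ∣ z ∣ ≤ a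
    bound₂   : ∀ {z} → z ∈M k → ∣ z ∣ ≤ b
    fresh    : ∀ {n} → n < a + b → c ≢ suc n
    clash    : 0ℤ ∈M j → 0ℤ ∈M k → c ≢ 0
    zero∈    : 0ℤ ∈M j ⊎ 0ℤ ∈M k → ∀ s → (s ◃ c) ∈M (j + k)
    nonzero∈ : ∀ {z} → z ≢ 0ℤ → ∣ z ∣ ≤ a + b → z ∈M (j + k)

jointPalette : ∀ j k → JointPalette j k
jointPalette j k with parity j | parity k
... | a , inj₁ refl | b , inj₁ refl = record
  -- Neither palette contains 0, so `c` never becomes a color; the value 0 makes `fresh` trivial.
  { a = a ; b = b ; c = 0
  ; bound₁ = λ z∈ → proj₂ (∈M-even⁻ a z∈)
  ; bound₂ = λ z∈ → proj₂ (∈M-even⁻ b z∈)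
  ; fresh = λ _ ()
  ; clash = λ 0∈ _ _ → proj₁ (∈M-even⁻ a 0∈) refl
  ; zero∈ = [ (λ 0∈ → contradiction refl (proj₁ (∈M-even⁻ a 0∈)))
            , (λ 0∈ → contradiction refl (proj₁ (∈M-even⁻ b 0∈))) ]′
  ; nonzero∈ = even (a + b) (sym (*-distribˡ-+ 2 a b))
  }
... | a , inj₁ refl | b , inj₂ refl = record
  -- The joint palette is odd and contains 0, and with `c = 0` both signs yield it.
  { a = a ; b = b ; c = 0
  ; bound₁ = λ z∈ → proj₂ (∈M-even⁻ a z∈)
  ; bound₂ = ∈M-odd⁻ b
  ; fresh = λ _ ()
  ; clash = λ 0∈ _ _ → proj₁ (∈M-even⁻ a 0∈) refl
  ; zero∈ = λ _ _ → odd (a + b) (eq a b) z≤n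
  ; nonzero∈ = λ _ → odd (a + b) (eq a b)
  }
  where
  eq : ∀ a b → 2 * a + (2 * b + 1) ≡ 2 * (a + b) + 1
  eq = solve-∀
... | a , inj₂ refl | b , inj₁ refl = record
  { a = a ; b = b ; c = 0
  ; bound₁ = ∈M-odd⁻ a
  ; bound₂ = λ z∈ → proj₂ (∈M-even⁻ b z∈)
  ; fresh = λ _ ()
  ; clash = λ _ 0∈ _ → proj₁ (∈M-even⁻ b 0∈) refl
  ; zero∈ = λ _ _ → odd (a + b) (eq a b) z≤n
  ; nonzero∈ = λ _ → odd (a + b) (eq a b)
  }
  where
  eq : ∀ a b → 2 * a + 1 + 2 * b ≡ 2 * (a + b) + 1
  eq = solve-∀
... | a , inj₂ refl | b , inj₂ refl = record
  -- The two zeros of the odd palettes make room for exactly one new pair of opposite colors.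
  { a = a ; b = b ; c = suc (a + b)
  ; bound₁ = ∈M-odd⁻ a
  ; bound₂ = ∈M-odd⁻ b
  ; fresh = λ n< eq → <⇒≢ n< (sym (suc-injective eq))
  ; clash = λ _ _ ()
  ; zero∈ = λ _ s → even (suc (a + b)) (eq a b)
      (λ s◃c≡0 → 1+n≢0 (trans (sym (ℤₚ.abs-◃ s (suc (a + b)))) (cong ∣_∣ s◃c≡0)))
      (≤-reflexive (ℤₚ.abs-◃ s (suc (a + b))))
  ; nonzero∈ = λ z≢0 z≤ → even (suc (a + b)) (eq a b) z≢0 (m≤n⇒m≤1+n z≤)
  }
  where
  eq : ∀ a b → 2 * a + 1 + (2 * b + 1) ≡ 2 * suc (a + b)
  eq = solve-∀

-- Recoloring

-- The sign `s` belongs to the vertex of the incidence: color 0 has no sign of its own to pass on to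
-- `c`.
shift : (d c : ℕ) → Sign → ℤ → ℤ
shift d c s +0       = s ◃ c
shift d c s +[1+ n ] = +[1+ d + n ]
shift d c s -[1+ n ] = -[1+ d + n ]

opposite-◃ : ∀ s n → opposite s ◃ n ≡ - (s ◃ n)
opposite-◃ s      zero    = refl
opposite-◃ Sign.+ (suc n) = refl
opposite-◃ Sign.- (suc n) = refl

-- Pushing nonzero colors outwards commutes with negation. Only at 0 does the sign rule have to come
-- from the vertex signs `s` and `s′` of the two ends.
shift-signed : ∀ d c t {s s′} y → (y ≡ 0ℤ → s ≡ opposite t Sign.* s′) →
  shift d c s ((- (t ◃ 1)) ℤ.* y) ≡ (- (t ◃ 1)) ℤ.* shift d c s′ y
shift-signed d c Sign.+ {s} {s′} y s≡ = begin
  shift d c s (ℤ.-1ℤ ℤ.* y)  ≡⟨ cong (shift d c s) (ℤₚ.-1*i≡-i y) ⟩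
  shift d c s (- y)          ≡⟨ shift-neg y s≡ ⟩
  - shift d c s′ y           ≡⟨ ℤₚ.-1*i≡-i _ ⟨
  ℤ.-1ℤ ℤ.* shift d c s′ y   ∎
  where
  open ≡-Reasoning
  shift-neg : ∀ y → (y ≡ 0ℤ → s ≡ opposite s′) → shift d c s (- y) ≡ - shift d c s′ y
  shift-neg +0       s≡ = trans (cong (_◃ c) (s≡ refl)) (opposite-◃ s′ c)
  shift-neg +[1+ _ ] _  = refl
  shift-neg -[1+ _ ] _  = refl
shift-signed d c Sign.- {s} {s′} y s≡ = begin
  shift d c s (ℤ.1ℤ ℤ.* y)   ≡⟨ cong (shift d c s) (ℤₚ.*-identityˡ y) ⟩
  shift d c s y              ≡⟨ shift-cong y s≡ ⟩
  shift d c s′ y             ≡⟨ ℤₚ.*-identityˡ _ ⟨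
  ℤ.1ℤ ℤ.* shift d c s′ y    ∎
  where
  open ≡-Reasoning
  shift-cong : ∀ y → (y ≡ 0ℤ → s ≡ s′) → shift d c s y ≡ shift d c s′ y
  shift-cong +0       s≡ = cong (_◃ c) (s≡ refl)
  shift-cong +[1+ _ ] _  = refl
  shift-cong -[1+ _ ] _  = refl

∣◃∣-injective : ∀ s {c} z → s ◃ c ≡ z → c ≡ ∣ z ∣
∣◃∣-injective s {c} z eq = trans (sym (ℤₚ.abs-◃ s c)) (cong ∣_∣ eq)

-- Nonzero colors keep their sign and their spacing, so the only possible collision is with the
-- image of 0, whose absolute value `c` is excluded by assumption.
shift-injective : ∀ {d b c s} → (∀ {n} → n < b → c ≢ suc (d + n)) →
  ∀ x y → ∣ x ∣ ≤ b → ∣ y ∣ ≤ b → shift d c s x ≡ shift d c s y → x ≡ y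
shift-injective fr +0 +0 _ _ _ = refl
shift-injective {s = s} fr +0 +[1+ n ] _ n< eq = ⊥-elim (fr n< (∣◃∣-injective s _ eq))
shift-injective {s = s} fr +0 -[1+ n ] _ n< eq = ⊥-elim (fr n< (∣◃∣-injective s _ eq))
shift-injective {s = s} fr +[1+ n ] +0 n< _ eq = ⊥-elim (fr n< (∣◃∣-injective s _ (sym eq)))
shift-injective {s = s} fr -[1+ n ] +0 n< _ eq = ⊥-elim (fr n< (∣◃∣-injective s _ (sym eq)))
shift-injective {d} fr +[1+ m ] +[1+ n ] _ _ eq =
  cong +[1+_] (+-cancelˡ-≡ d m n (ℤₚ.+[1+-injective eq))
shift-injective {d} fr -[1+ m ] -[1+ n ] _ _ eq =
  cong -[1+_] (+-cancelˡ-≡ d m n (ℤₚ.-[1+-injective eq))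

module _ {j k : ℕ} (P : JointPalette j k) where
  open JointPalette P

  shift-∈M : ∀ {d s x} → (x ≡ 0ℤ → 0ℤ ∈M j ⊎ 0ℤ ∈M k) → d + ∣ x ∣ ≤ a + b →
             shift d c s x ∈M (j + k)
  shift-∈M {s = s} {+0} z _ = zero∈ (z refl) s
  shift-∈M {d} {x = +[1+ n ]} _ le = nonzero∈ (λ ()) (subst (_≤ a + b) (+-suc d n) le)
  shift-∈M {d} {x = -[1+ n ]} _ le = nonzero∈ (λ ()) (subst (_≤ a + b) (+-suc d n) le)

  -- Nonzero colors of the two factors land on absolute values up to `a` and above `a` respectively,
  -- and `c` meets neither range. Two zeros at the same vertex are separated by their opposite
  -- signs.
  shift-disjoint : ∀ s {x y} → x ∈M j → y ∈M k →
                   shift 0 c s x ≢ shift a c (opposite s) y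
  shift-disjoint s x∈ y∈ = go _ _ x∈ y∈ (bound₁ x∈) (bound₂ y∈)
    where
    inner≢outer : ∀ {m n} → m < a → m ≢ a + n
    inner≢outer {n = n} m<a refl = m+n≮m a n m<a
    go : ∀ x y → x ∈M j → y ∈M k → ∣ x ∣ ≤ a → ∣ y ∣ ≤ b →
         shift 0 c s x ≢ shift a c (opposite s) y
    go +0 +0 0∈₁ 0∈₂ _ _ eq with ℤₚ.sign-cong′ {s} {c} {opposite s} {c} eq
    ... | inj₁ s≡ = Signₚ.s≢opposite[s] s s≡
    ... | inj₂ (c≡0 , _) = clash 0∈₁ 0∈₂ c≡0
    go +0 +[1+ n ] _ _ _ n< eq = fresh (+-monoʳ-< a n<) (∣◃∣-injective s _ eq)
    go +0 -[1+ n ] _ _ _ n< eq = fresh (+-monoʳ-< a n<) (∣◃∣-injective s _ eq)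
    go +[1+ m ] +0 _ _ m< _ eq =
      fresh (≤-trans m< (m≤m+n a b)) (∣◃∣-injective (opposite s) _ (sym eq))
    go -[1+ m ] +0 _ _ m< _ eq =
      fresh (≤-trans m< (m≤m+n a b)) (∣◃∣-injective (opposite s) _ (sym eq))
    go +[1+ m ] +[1+ n ] _ _ m< _ eq = inner≢outer m< (ℤₚ.+[1+-injective eq)
    go -[1+ m ] -[1+ n ] _ _ m< _ eq = inner≢outer m< (ℤₚ.-[1+-injective eq)

-- Edge colorings

module _ {S : SignedGraph U} where
  open SignedGraph S hiding (Δ)

  degree≤Δ : ∀ {u} → u ∈ vertices → degree u ≤ Δ S
  degree≤Δ u∈ = All.lookup (xs≤max 0 (map degree vertices)) (∈-map⁺ degree u∈)

  ∃-degree≥Δ : ∀ {x} → x ∈ vertices → ∃ λ u → u ∈ vertices × Δ S ≤ degree u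
  ∃-degree≥Δ {x} x∈ with argmax-sel (λ n → n) 0 (map degree vertices)
  -- The maximum may be the default value 0 instead of a degree; then any vertex will do.
  ... | inj₁ Δ≡0 = x , x∈ , ≤-trans (≤-reflexive Δ≡0) z≤n
  ... | inj₂ Δ∈ with ∈-map⁻ degree Δ∈
  ...   | u , u∈ , Δ≡ = u , u∈ , ≤-reflexive Δ≡

module _ {S : SignedGraph U} (f : EdgeColoring S k) where
  open SignedGraph S hiding (Δ)
  open EdgeColoring f

  color-injective : ∀ {u v w} (e : Adj u v) (e′ : Adj u w) → color e ≡ color e′ → v ≡ w
  color-injective {v = v} {w} e e′ eq = decidable-stable (v ≟ w) λ v≢w → proper e e′ v≢w eq

  σ-irrelevant : ∀ {u v} (e e′ : Adj u v) → σ e ≡ σ e′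
  σ-irrelevant e e′ = trans (σ-edge e (Adj-sym e)) (sym (σ-edge e′ (Adj-sym e)))

  -- Both colors are determined by that of one common reverse incidence.
  color-irrelevant : ∀ {u v} (e e′ : Adj u v) → color e ≡ color e′
  color-irrelevant e e′ = begin
    color e                                       ≡⟨ signed e (Adj-sym e) ⟩
    (- (σ e ◃ 1)) ℤ.* color (Adj-sym e)           ≡⟨ cong (λ s → (- (s ◃ 1)) ℤ.* color (Adj-sym e)) (σ-irrelevant e e′) ⟩
    (- (σ e′ ◃ 1)) ℤ.* color (Adj-sym e)          ≡⟨ signed e′ (Adj-sym e) ⟨
    color e′                                      ∎
    where open ≡-Reasoning

  color-sym≡0 : ∀ {u v} (e : Adj u v) (e′ : Adj v u) → color e ≡ 0ℤ → color e′ ≡ 0ℤ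
  color-sym≡0 e e′ e≡0 =
    trans (signed e′ e) (trans (cong (- (σ e′ ◃ 1) ℤ.*_) e≡0) (ℤₚ.*-zeroʳ (- (σ e′ ◃ 1))))

  -- The incidences at `u` have distinct colors in `M k`, which injects into `Fin k`.
  degree≤colors : ∀ u → degree u ≤ k
  degree≤colors u = injective⇒≤ {f = λ i → index (range (edge i))} λ {i} {i′} eq →
    lookup-injective (filter⁺ (Adj? u) unique)
      (color-injective (edge i) (edge i′) (injective (range (edge i)) (range (edge i′)) eq))
    where
    open M-Index (M-index k)
    nbrs : List U
    nbrs = filter (Adj? u) vertices
    edge : ∀ i → Adj u (lookup nbrs i)
    edge i = proj₂ (∈-filter⁻ (Adj? u) {xs = vertices} (∈-lookup {xs = nbrs} i))

  Δ≤colors : Δ S ≤ k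
  Δ≤colors = max≤v⁺ z≤n (Allₚ.map⁺ (All.universal degree≤colors vertices))

  -- This is the rule that `signed` imposes on nonzero replacement colors for 0-edges, with
  -- `opposite (σ e)` standing for the factor -σ. Restricting it to `xs` allows `g` to be built one
  -- vertex at a time.
  Compatible : (U → Sign) → List U → Set
  Compatible g xs = ∀ {u v} → u ∈ xs → v ∈ xs → (e : Adj u v) → color e ≡ 0ℤ →
                    g v ≡ opposite (σ e) Sign.* g u

  private
    cancel : ∀ s t → t ≡ s Sign.* (s Sign.* t)
    cancel s t = trans (cong (Sign._* t) (sym (Signₚ.s*s≡+ s))) (Signₚ.*-assoc s s t)

    ZeroEdge : U → U → Set
    ZeroEdge u v = Σ (Adj u v) λ e → color e ≡ 0ℤ

    zeroEdge? : ∀ u v → Dec (ZeroEdge u v)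
    zeroEdge? u v with Adj? u v
    ... | no ¬e = no λ (e , _) → ¬e e
    ... | yes e with color e ℤₚ.≟ 0ℤ
    ...   | yes e≡0 = yes (e , e≡0)
    ...   | no e≢0 = no λ (e′ , e′≡0) → e≢0 (trans (color-irrelevant e e′) e′≡0)

    -- By properness `x` lies on at most one 0-edge, so at most one vertex of `xs` constrains its
    -- sign.
    extend : ∀ (g : U → Sign) x xs → ∃ λ s → ∀ {v} → v ∈ xs → (e : Adj x v) → color e ≡ 0ℤ →
             g v ≡ opposite (σ e) Sign.* s
    extend g x xs with any? (zeroEdge? x) xs
    ... | no none = Sign.+ , λ v∈ e e≡0 → contradiction (lose v∈ (e , e≡0)) none
    ... | yes some with find some
    -- The constraint from `w` is solved for the sign of `x`, using that every sign is its own
    -- inverse.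
    ...   | w , _ , e₀ , e₀≡0 = opposite (σ e₀) Sign.* g w , matched
      where
      matched : ∀ {v} → v ∈ xs → (e : Adj x v) → color e ≡ 0ℤ →
                g v ≡ opposite (σ e) Sign.* (opposite (σ e₀) Sign.* g w)
      matched v∈ e e≡0 with refl ← color-injective e e₀ (trans e≡0 (sym e₀≡0))
        rewrite σ-irrelevant e e₀ = cancel (opposite (σ e₀)) (g w)

  -- Greedy labeling along the list: each new vertex meets at most one constraint, and since it does
  -- not occur in the rest of the list, labeling it leaves the earlier signs intact.
  ∃-compatible : ∀ {xs} → Unique xs → ∃ λ g → Compatible g xs
  ∃-compatible {[]} [] = (λ _ → Sign.+) , λ ()
  ∃-compatible {x ∷ xs} (x∉ ∷ uniq) with ∃-compatible uniq
  ... | g , g-compatible with extend g x xs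
  ...   | s , s-matched = g′ , g′-compatible
    where
    g′ : U → Sign
    g′ u with x ≟ u
    ... | yes _ = s
    ... | no _  = g u
    g′-here : g′ x ≡ s
    g′-here with x ≟ x
    ... | yes _   = refl
    ... | no x≢x = contradiction refl x≢x
    g′-there : ∀ {u} → u ∈ xs → g′ u ≡ g u
    g′-there {u} u∈ with x ≟ u
    ... | yes x≡u = contradiction x≡u (All.lookup x∉ u∈)
    ... | no _    = refl
    g′-compatible : Compatible g′ (x ∷ xs)
    g′-compatible (here refl) (here refl) e _ = contradiction e Adj-irr
    g′-compatible (here refl) (there v∈) e e≡0
      rewrite g′-here | g′-there v∈ = s-matched v∈ e e≡0
    -- The edge now points towards `x`, so the equation for its reverse is inverted.
    g′-compatible {u} (there u∈) (here refl) e e≡0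
      rewrite g′-here | g′-there u∈ = begin
        s                                          ≡⟨ cancel (opposite (σ e)) s ⟩
        opposite (σ e) Sign.* (opposite (σ e) Sign.* s)
          ≡⟨ cong (λ t → opposite (σ e) Sign.* (opposite t Sign.* s)) (σ-edge e (Adj-sym e)) ⟩
        opposite (σ e) Sign.* (opposite (σ (Adj-sym e)) Sign.* s)
          ≡⟨ cong (opposite (σ e) Sign.*_) (s-matched u∈ (Adj-sym e) (color-sym≡0 e (Adj-sym e) e≡0)) ⟨
        opposite (σ e) Sign.* g u                  ∎
      where open ≡-Reasoning
    g′-compatible (there u∈) (there v∈) e e≡0
      rewrite g′-there u∈ | g′-there v∈ = g-compatible u∈ v∈ e e≡0

-- Every coloring needs at least `Δ S` colors, so one with no more than that is optimal.
coloring⇒chromaticIndex : {S : SignedGraph U} → EdgeColoring S k → k ≤ Δ S → ChromaticIndex S (Δ S)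
coloring⇒chromaticIndex {S = S} f k≤Δ =
  subst (EdgeColoring S) (≤-antisym k≤Δ (Δ≤colors f)) f , λ _ → Δ≤colors

-- The Cartesian product

module _ (S₁ : SignedGraph U) (S₂ : SignedGraph W) where
  private
    module G₁ = SignedGraph S₁
    module G₂ = SignedGraph S₂
    module G  = SignedGraph (S₁ □ S₂)

  -- The neighbors of `u` and those of `u′` give two families of neighbors of the pair, with no
  -- common member. An inequality suffices, as the coloring of the product bounds its degrees from
  -- above.
  degree-□ : ∀ {u u′} → u ∈ G₁.vertices → u′ ∈ G₂.vertices →
             G₁.degree u + G₂.degree u′ ≤ G.degree (u , u′)
  degree-□ {u} {u′} u∈ u′∈ = begin
    length nbrs₁ + length nbrs₂              ≡⟨ cong₂ _+_ (length-map (_, u′) nbrs₁) (length-map (u ,_) nbrs₂) ⟨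
    length copy₁ + length copy₂              ≡⟨ length-++ copy₁ ⟨
    length (copy₁ ++ copy₂)                  ≤⟨ Unique-⊆⇒length≤ copies-unique copies-⊆ ⟩
    G.degree (u , u′)                        ∎
    where
    open ≤-Reasoning
    nbrs₁ = filter (G₁.Adj? u) G₁.vertices
    nbrs₂ = filter (G₂.Adj? u′) G₂.vertices
    copy₁ = map (_, u′) nbrs₁
    copy₂ = map (u ,_) nbrs₂

    copies-unique : Unique (copy₁ ++ copy₂)
    copies-unique = ++⁺ (map⁺ ,-injectiveˡ (filter⁺ (G₁.Adj? u) G₁.unique))
                        (map⁺ ,-injectiveʳ (filter⁺ (G₂.Adj? u′) G₂.unique))
                        disjoint
      where
      disjoint : ∀ {p} → ¬ (p ∈ copy₁ × p ∈ copy₂)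
      disjoint (p∈₁ , p∈₂) with ∈-map⁻ (_, u′) p∈₁ | ∈-map⁻ (u ,_) p∈₂
      ... | _ , v∈ , refl | _ , _ , refl =
        -- A common member could only be `(u , u′)` itself, making `u` its own neighbor.
        G₁.Adj-irr (proj₂ (∈-filter⁻ (G₁.Adj? u) {xs = G₁.vertices} v∈))

    copies-⊆ : copy₁ ++ copy₂ ⊆ filter (G.Adj? (u , u′)) G.vertices
    copies-⊆ p∈ with ∈-++⁻ copy₁ p∈
    ... | inj₁ p∈₁ with ∈-map⁻ (_, u′) p∈₁
    ...   | _ , v∈ , refl with ∈-filter⁻ (G₁.Adj? u) {xs = G₁.vertices} v∈
    ...     | v∈V , e = ∈-filter⁺ (G.Adj? (u , u′)) (∈-cartesianProduct⁺ v∈V u′∈) (inj₂ (e , refl , u′∈))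
    copies-⊆ p∈ | inj₂ p∈₂ with ∈-map⁻ (u ,_) p∈₂
    ...   | _ , v∈ , refl with ∈-filter⁻ (G₂.Adj? u′) {xs = G₂.vertices} v∈
    ...     | v∈V , e = ∈-filter⁺ (G.Adj? (u , u′)) (∈-cartesianProduct⁺ u∈ v∈V) (inj₁ (refl , u∈ , e))

  Δ+Δ≤Δ-□ : ∀ {x y} → x ∈ G₁.vertices → y ∈ G₂.vertices → Δ S₁ + Δ S₂ ≤ Δ (S₁ □ S₂)
  Δ+Δ≤Δ-□ x∈ y∈ with ∃-degree≥Δ {S = S₁} x∈ | ∃-degree≥Δ {S = S₂} y∈
  ... | u , u∈ , Δ≤₁ | u′ , u′∈ , Δ≤₂ = begin
    Δ S₁ + Δ S₂                  ≤⟨ +-mono-≤ Δ≤₁ Δ≤₂ ⟩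
    G₁.degree u + G₂.degree u′   ≤⟨ degree-□ u∈ u′∈ ⟩
    G.degree (u , u′)            ≤⟨ degree≤Δ {S = S₁ □ S₂} (∈-cartesianProduct⁺ u∈ u′∈) ⟩
    Δ (S₁ □ S₂)                  ∎
    where open ≤-Reasoning

  edgeColoring-□ : ∀ {j k} → EdgeColoring S₁ j → EdgeColoring S₂ k → EdgeColoring (S₁ □ S₂) (j + k)
  edgeColoring-□ {j} {k} f₁ f₂ = record
    { color  = color
    ; range  = range
    ; signed = signed
    ; proper = proper
    }
    where
    module F₁ = EdgeColoring f₁
    module F₂ = EdgeColoring f₂
    P = jointPalette j k
    open JointPalette P

    g₁ : U → Sign
    g₁ = proj₁ (∃-compatible f₁ G₁.unique)
    g₂ : W → Sign
    g₂ = proj₁ (∃-compatible f₂ G₂.unique)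

    -- An edge of the product changes only one coordinate, so the other factor of `g` is constant
    -- along it and `g` obeys the sign rules of both factors at once.
    g : U × W → Sign
    g (u , u′) = g₁ u Sign.* g₂ u′

    -- In `shift-signed` the color assumed to be 0 is the one at the far end, so compatibility is
    -- applied to the reversed edge `e′`.
    g-step₁ : ∀ {u v u′} (e : G₁.Adj u v) (e′ : G₁.Adj v u) → F₁.color e′ ≡ 0ℤ →
              g (u , u′) ≡ opposite (G₁.σ e) Sign.* g (v , u′)
    g-step₁ {u} {v} {u′} e e′ e′≡0 = begin
      g₁ u Sign.* g₂ u′                                  ≡⟨ cong (Sign._* g₂ u′) (proj₂ (∃-compatible f₁ G₁.unique) (G₁.Adj-∈ e′) (G₁.Adj-∈ e) e′ e′≡0) ⟩
      (opposite (G₁.σ e′) Sign.* g₁ v) Sign.* g₂ u′      ≡⟨ Signₚ.*-assoc (opposite (G₁.σ e′)) (g₁ v) (g₂ u′) ⟩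
      opposite (G₁.σ e′) Sign.* g (v , u′)               ≡⟨ cong (λ s → opposite s Sign.* g (v , u′)) (G₁.σ-edge e′ e) ⟩
      opposite (G₁.σ e) Sign.* g (v , u′)                ∎
      where open ≡-Reasoning

    g-step₂ : ∀ {u u′ v′} (e : G₂.Adj u′ v′) (e′ : G₂.Adj v′ u′) → F₂.color e′ ≡ 0ℤ →
              opposite (g (u , u′)) ≡ opposite (G₂.σ e) Sign.* opposite (g (u , v′))
    g-step₂ {u} {u′} {v′} e e′ e′≡0 = begin
      opposite (g₁ u Sign.* g₂ u′)                                      ≡⟨ cong (λ s → opposite (g₁ u Sign.* s)) (proj₂ (∃-compatible f₂ G₂.unique) (G₂.Adj-∈ e′) (G₂.Adj-∈ e) e′ e′≡0) ⟩
      opposite (g₁ u Sign.* (opposite (G₂.σ e′) Sign.* g₂ v′))          ≡⟨ swap (g₁ u) (opposite (G₂.σ e′)) (g₂ v′) ⟩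
      opposite (G₂.σ e′) Sign.* opposite (g (u , v′))                   ≡⟨ cong (λ s → opposite s Sign.* opposite (g (u , v′))) (G₂.σ-edge e′ e) ⟩
      opposite (G₂.σ e) Sign.* opposite (g (u , v′))                    ∎
      where
      open ≡-Reasoning
      swap : ∀ r s t → opposite (r Sign.* (s Sign.* t)) ≡ s Sign.* opposite (r Sign.* t)
      swap Sign.+ Sign.+ _      = refl
      swap Sign.- Sign.+ _      = refl
      swap Sign.+ Sign.- _      = refl
      swap Sign.- Sign.- _      = refl

    color : ∀ {p q} → G.Adj p q → ℤ
    -- Taking the opposite sign at both ends preserves the rule along the edge, and separates this
    -- 0-edge from one of `S₁` at the same vertex.
    color {p} (inj₁ (_ , _ , e)) = shift a c (opposite (g p)) (F₂.color e)
    color {p} (inj₂ (e , _ , _)) = shift 0 c (g p) (F₁.color e)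

    range : ∀ {p q} (e : G.Adj p q) → color e ∈M (j + k)
    range (inj₁ (_ , _ , e)) =
      shift-∈M P (λ e≡0 → inj₂ (subst (_∈M k) e≡0 (F₂.range e))) (+-monoʳ-≤ a (bound₂ (F₂.range e)))
    range (inj₂ (e , _ , _)) =
      shift-∈M P (λ e≡0 → inj₁ (subst (_∈M j) e≡0 (F₁.range e))) (≤-trans (bound₁ (F₁.range e)) (m≤m+n a b))

    signed : ∀ {p q} (e : G.Adj p q) (e′ : G.Adj q p) → color e ≡ (- (G.σ e ◃ 1)) ℤ.* color e′
    signed {p} (inj₁ (refl , _ , e)) (inj₁ (_ , _ , e′)) =
      trans (cong (shift a c (opposite (g p))) (F₂.signed e e′))
            (shift-signed a c (G₂.σ e) (F₂.color e′) (g-step₂ e e′))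
    signed (inj₁ (refl , _ , _)) (inj₂ (e′ , _ , _)) = contradiction e′ G₁.Adj-irr
    signed (inj₂ (e , _ , _)) (inj₁ (refl , _ , _)) = contradiction e G₁.Adj-irr
    signed {p} (inj₂ (e , refl , _)) (inj₂ (e′ , _ , _)) =
      trans (cong (shift 0 c (g p)) (F₁.signed e e′))
            (shift-signed 0 c (G₁.σ e) (F₁.color e′) (g-step₁ e e′))

    proper : ∀ {p q r} (e : G.Adj p q) (e′ : G.Adj p r) → q ≢ r → color e ≢ color e′
    proper (inj₁ (refl , _ , e)) (inj₁ (refl , _ , e′)) q≢r eq =
      q≢r (cong (_ ,_) (color-injective f₂ e e′
        (shift-injective (λ n< → fresh (+-monoʳ-< a n<)) _ _ (bound₂ (F₂.range e)) (bound₂ (F₂.range e′)) eq)))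
    proper {p} (inj₁ (_ , _ , e)) (inj₂ (e′ , _ , _)) _ eq =
      shift-disjoint P (g p) (F₁.range e′) (F₂.range e) (sym eq)
    proper {p} (inj₂ (e , _ , _)) (inj₁ (_ , _ , e′)) _ eq =
      shift-disjoint P (g p) (F₁.range e) (F₂.range e′) eq
    proper (inj₂ (e , refl , _)) (inj₂ (e′ , refl , _)) q≢r eq =
      q≢r (cong (_, _) (color-injective f₁ e e′
        (shift-injective (λ n< → fresh (≤-trans n< (m≤m+n a b))) _ _ (bound₁ (F₁.range e)) (bound₁ (F₁.range e′)) eq)))

-- Empty factors and the conclusion.

empty-edgeColoring : {S : SignedGraph U} → (∀ {u} → ¬ u ∈ SignedGraph.vertices S) → EdgeColoring S 0
empty-edgeColoring {S = S} empty = record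
  { color  = λ _ → 0ℤ
  ; range  = λ e → contradiction (Adj-∈ e) empty
  ; signed = λ e _ → contradiction (Adj-∈ e) empty
  ; proper = λ e _ _ → contradiction (Adj-∈ e) empty
  }
  where open SignedGraph S

empty⊎inhabited : (xs : List A) → (∀ {x} → ¬ x ∈ xs) ⊎ ∃ (_∈ xs)
empty⊎inhabited []      = inj₁ λ ()
empty⊎inhabited (x ∷ _) = inj₂ (x , here refl)

theorem6 : ∀ {U : Set} (S₁ S₂ : SignedGraph U) → EdgeDisjoint S₁ S₂ → ChromaticIndex S₁ (Δ S₁) → ChromaticIndex S₂ (Δ S₂) → ChromaticIndex (S₁ □ S₂) (Δ (S₁ □ S₂))
theorem6 S₁ S₂ _ (f₁ , _) (f₂ , _)
  with empty⊎inhabited (SignedGraph.vertices S₁) | empty⊎inhabited (SignedGraph.vertices S₂)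
-- The other factor may still have positive maximum degree, but the product has no vertices, so it
-- is colored with 0 colors directly.
... | inj₁ empty | _ =
  coloring⇒chromaticIndex (empty-edgeColoring {S = S₁ □ S₂} λ p∈ →
    empty (proj₁ (∈-cartesianProduct⁻ _ (SignedGraph.vertices S₂) p∈))) z≤n
... | inj₂ _ | inj₁ empty =
  coloring⇒chromaticIndex (empty-edgeColoring {S = S₁ □ S₂} λ p∈ →
    empty (proj₂ (∈-cartesianProduct⁻ (SignedGraph.vertices S₁) _ p∈))) z≤n
-- The combined coloring uses `Δ S₁ + Δ S₂` colors, which the product of two maximum-degree vertices
-- shows to be at most the maximum degree of the product.
... | inj₂ (_ , x∈) | inj₂ (_ , y∈) =
  coloring⇒chromaticIndex (edgeColoring-□ S₁ S₂ f₁ f₂) (Δ+Δ≤Δ-□ S₁ S₂ x∈ y∈)
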